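{- Let $k\ge 2$ and $d\ge 1$ be integers, and let $t\ge 2$ be an integer relatively prime to $k$. There is a $d$-regular digraph, with every edge labelled by the constant $1\in\mathbb{Z}_k$, in which every zero-sum directed cycle has length at least $tk$, and which consequently satisfies the following: it contains at most $\lfloor d/k\rfloor$ pairwise vertex-disjoint zero-sum cycles and at most $\lfloor d^2/k\rfloor$ pairwise edge-disjoint zero-sum cycles; and if $d<k$, it has no zero-sum cycle.
   Context: All digraphs are finite, nonempty, simple and loopless: for each ordered pair $(u,v)$ there is at most one edge from $u$ to $v$, there are no edges from a vertex to itself, and both opposite edges $uv$ and $vu$ may be present. A digraph is $d$-regular if every vertex has outdegree $d$ and indegree $d$. A directed cycle $C=v_1v_2\cdots v_\ell v_1$ has distinct vertices $v_1,\dots,v_\ell$ and all displayed edges in the digraph (so $\ell\ge 2$); its length is $\ell$; cycles differing by cyclic rotation are the same. $\mathbb{Z}_k$ is the cyclic group of integers modulo $k$ under addition. For an edge-labelling by $\mathbb{Z}_k$, a directed cycle is zero-sum if the sum of its edge labels is $0$ in $\mathbb{Z}_k$. -}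

module Defs where

open import Data.Bool using (Bool; T)
open import Data.Fin using (Fin; toℕ)
open import Data.Fin.Properties using (nonZeroIndex)
open import Data.Fin.Subset using (Subset; ∣_∣)
open import Data.Nat using (ℕ; suc; _+_; _≤_; NonZero)
open import Data.Nat.DivMod using (_mod_)
open import Data.Product using (_×_; _,_)
open import Data.Vec using (tabulate)
open import Data.Vec.Functional using (Vector; foldr)
open import Function.Definitions using (Injective)
open import Relation.Binary.PropositionalEquality using (_≡_; _≢_)
open import Relation.Nullary using (¬_)

ℤmod : ℕ → Set
ℤmod k = Fin k

module _ {k : ℕ} .{{_ : NonZero k}} where

  0ₖ 1ₖ : ℤmod k
  0ₖ = 0 mod k
  1ₖ = 1 mod k

  infixl 6 _+ₖ_
  _+ₖ_ : ℤmod k → ℤmod k → ℤmod k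
  a +ₖ b = (toℕ a + toℕ b) mod k

  sumₖ : ∀ {n} → Vector (ℤmod k) n → ℤmod k
  sumₖ = foldr _+ₖ_ 0ₖ

record Digraph : Set where
  field
    order    : ℕ
    nonempty : NonZero order
    adj      : Fin order → Fin order → Bool
    loopless : ∀ v → ¬ T (adj v v)

  Vertex : Set
  Vertex = Fin order

  Edge : Vertex → Vertex → Set
  Edge u v = T (adj u v)

  outNeighbours inNeighbours : Vertex → Subset order
  outNeighbours v = tabulate (λ w → adj v w)
  inNeighbours  v = tabulate (λ u → adj u v)

  outdegree indegree : Vertex → ℕ
  outdegree v = ∣ outNeighbours v ∣
  indegree  v = ∣ inNeighbours v ∣

Regular : ℕ → Digraph → Set
Regular d G = ∀ v → outdegree v ≡ d × indegree v ≡ d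
  where open Digraph G

-- `Edge u v` has at most one inhabitant, so a labelling assigns exactly one
-- element of ℤ_k to each edge.
Labelling : Digraph → ℕ → Set
Labelling G k = ∀ {u v} → Digraph.Edge G u v → ℤmod k

constant : ∀ {G k} → ℤmod k → Labelling G k
constant a _ = a

-- Successor modulo ℓ: the last index is followed by the first.
next : ∀ {ℓ} → Fin ℓ → Fin ℓ
next {ℓ} i = _mod_ (suc (toℕ i)) ℓ {{nonZeroIndex i}}

-- A directed cycle with a chosen starting vertex. Rotations of one cycle are
-- different records, but length, label sum and disjointness do not depend on
-- the starting vertex, and a cycle is never disjoint from its own rotations.
record Cycle (G : Digraph) : Set where
  open Digraph G
  field
    length   : ℕ
    2≤length : 2 ≤ length
    vertex   : Fin length → Vertex
    distinct : Injective _≡_ _≡_ vertex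
    edge     : ∀ i → Edge (vertex i) (vertex (next i))

  ends : Fin length → Vertex × Vertex
  ends i = vertex i , vertex (next i)

open Cycle using (length) public

ZeroSum : ∀ {G k} .{{_ : NonZero k}} → Labelling G k → Cycle G → Set
ZeroSum lab C = sumₖ (λ i → lab (edge i)) ≡ 0ₖ
  where open Cycle C

VertexDisjoint EdgeDisjoint : ∀ {G} → Cycle G → Cycle G → Set
VertexDisjoint C D = ∀ i j → Cycle.vertex C i ≢ Cycle.vertex D j
EdgeDisjoint   C D = ∀ i j → Cycle.ends C i ≢ Cycle.ends D j

-- Every family of pairwise R-related cycles satisfying P has at most b members.
-- For a disjointness relation R, members at different indices are different
-- cycles, so families count the same as sets of cycles.
AtMost : ∀ {G} → ℕ → (Cycle G → Cycle G → Set) → (Cycle G → Set) → Set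
AtMost {G} b R P =
  ∀ m (C : Fin m → Cycle G) →
  (∀ i → P (C i)) →
  (∀ i j → i ≢ j → R (C i) (C j)) →
  m ≤ b

-- Replace every vertex of a directed t-cycle by d independent copies. Levels
-- advance by one modulo t along each edge, so t divides the length of every
-- cycle. With all labels 1 a cycle is zero-sum iff k divides its length, so by
-- coprimality a zero-sum cycle has length at least tk. There are only td vertices
-- and td² edges to share among disjoint zero-sum cycles.
module Submission where

open import Defs
open import Data.Bool using (Bool; true; false)
open import Data.Bool.Properties using (T-≡)
open import Data.Fin using (Fin; zero; suc; toℕ; inject≤; combine; remQuot; quotient; remainder; _↑ˡ_; _↑ʳ_; _≟_)
open import Data.Fin.Properties using (toℕ-injective; toℕ-fromℕ<; toℕ<n; inject≤-injective; splitAt-↑ˡ; splitAt-↑ʳ; combine-injective; combine-remQuot; injective⇒≤)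
open import Data.Fin.Subset using (∣_∣; ⁅_⁆; _∈_)
open import Data.Fin.Subset.Properties using (⊆-antisym; x∈⁅x⁆; x∈⁅y⁆⇒x≡y; ∣⁅x⁆∣≡1)
open import Data.Nat using (ℕ; zero; suc; _+_; _*_; _^_; _≤_; _<_; s≤s; z<s; NonZero; >-nonZero)
open import Data.Nat.Coprimality as Coprimality using (Coprime; coprime-divisor)
open import Data.Nat.DivMod using (_/_; _%_; _mod_; m%n<n; m<n⇒m%n≡m; m%n%n≡m%n; [m+n]%n≡m%n; [m+kn]%n≡m%n; %-distribˡ-+; /-monoˡ-≤; m*n/n≡m; m<n⇒m/n≡0)
open import Data.Nat.Divisibility using (_∣_; divides-refl; m%n≡0⇒n∣m; n∣m⇒m%n≡0; ∣⇒≤; *-monoʳ-∣)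
open import Data.Nat.Properties using (*-assoc; *-cancelˡ-≤; *-comm; *-identityʳ; *-identityˡ; *-suc; +-assoc; +-comm; +-identityʳ; +-suc; 0≢1+n; <-trans; m*n≢0; n≮0)
open import Data.Product using (Σ-syntax; _×_; _,_; proj₁; proj₂; uncurry)
open import Data.Product.Properties using (,-injectiveˡ)
open import Data.Vec using (_∷_; tabulate)
open import Data.Vec.Properties using (lookup∘tabulate; tabulate-cong; lookup⇒[]=; []=⇒lookup)
open import Function using (_∘_; const)
open import Function.Bundles using (Equivalence)
open import Function.Definitions using (Injective)
open import Relation.Binary.PropositionalEquality using (_≡_; _≢_; refl; sym; trans; cong; cong₂; subst; module ≡-Reasoning)
open import Relation.Nullary using (¬_; Dec; yes; no; contradiction)
open import Relation.Nullary.Decidable using (⌊_⌋; toWitness; fromWitness)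

open ≡-Reasoning

-- Arithmetic modulo `n` and the cyclic successor.

toℕ-mod : ∀ m n .{{_ : NonZero n}} → toℕ (m mod n) ≡ m % n
toℕ-mod m n = toℕ-fromℕ< (m%n<n m n)

%-cong-+ˡ : ∀ c {a b} n .{{_ : NonZero n}} → a % n ≡ b % n → (c + a) % n ≡ (c + b) % n
%-cong-+ˡ c {a} {b} n a≡b = begin
  (c + a) % n          ≡⟨ %-distribˡ-+ c a n ⟩
  (c % n + a % n) % n  ≡⟨ cong (λ x → (c % n + x) % n) a≡b ⟩
  (c % n + b % n) % n  ≡⟨ %-distribˡ-+ c b n ⟨
  (c + b) % n          ∎

-- Adding c * (n - 1) to both sides turns c into a multiple of n.
%-cancel-+ˡ : ∀ c {a b} n .{{_ : NonZero n}} → (c + a) % n ≡ (c + b) % n → a % n ≡ b % n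
%-cancel-+ˡ c {a} {b} n@(suc n-1) eq = begin
  a % n                      ≡⟨ complete a ⟨
  (c * n-1 + (c + a)) % n    ≡⟨ %-cong-+ˡ (c * n-1) n eq ⟩
  (c * n-1 + (c + b)) % n    ≡⟨ complete b ⟩
  b % n                      ∎
  where
  complete : ∀ x → (c * n-1 + (c + x)) % n ≡ x % n
  complete x = begin
    (c * n-1 + (c + x)) % n  ≡⟨ cong (_% n) (+-assoc (c * n-1) c x) ⟨
    (c * n-1 + c + x) % n    ≡⟨ cong (λ y → (y + x) % n) (trans (+-comm (c * n-1) c) (sym (*-suc c n-1))) ⟩
    (c * n + x) % n          ≡⟨ cong (_% n) (+-comm (c * n) x) ⟩
    (x + c * n) % n          ≡⟨ [m+kn]%n≡m%n x c n ⟩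
    x % n                    ∎

toℕ-next : ∀ {n} .{{_ : NonZero n}} (i : Fin n) → toℕ (next i) ≡ suc (toℕ i) % n
toℕ-next {n@(suc _)} i = toℕ-mod (suc (toℕ i)) n

toℕ-% : ∀ {n} .{{_ : NonZero n}} (i : Fin n) → toℕ i % n ≡ toℕ i
toℕ-% i = m<n⇒m%n≡m (toℕ<n i)

next-mod : ∀ m n .{{_ : NonZero n}} → next (m mod n) ≡ suc m mod n
next-mod m n = toℕ-injective (begin
  toℕ (next (m mod n))     ≡⟨ toℕ-next (m mod n) ⟩
  suc (toℕ (m mod n)) % n  ≡⟨ cong (λ x → suc x % n) (toℕ-mod m n) ⟩
  suc (m % n) % n          ≡⟨ %-cong-+ˡ 1 n (m%n%n≡m%n m n) ⟩
  suc m % n                ≡⟨ toℕ-mod (suc m) n ⟨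
  toℕ (suc m mod n)        ∎)

next-injective : ∀ {n} → Injective _≡_ _≡_ (next {n})
next-injective {suc n-1} {i} {j} eq = toℕ-injective (begin
  toℕ i      ≡⟨ toℕ-% i ⟨
  toℕ i % n  ≡⟨ %-cancel-+ˡ 1 n (trans (sym (toℕ-next i)) (trans (cong toℕ eq) (toℕ-next j))) ⟩
  toℕ j % n  ≡⟨ toℕ-% j ⟩
  toℕ j      ∎)
  where n = suc n-1

-- Adding `n-1` subtracts one modulo `n` without leaving the naturals.
prev : ∀ {n} → Fin n → Fin n
prev {suc n-1} i = (toℕ i + n-1) mod suc n-1

next-prev : ∀ {n} (i : Fin n) → next (prev i) ≡ i
next-prev {n@(suc n-1)} i = begin
  next ((toℕ i + n-1) mod n)  ≡⟨ next-mod (toℕ i + n-1) n ⟩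
  suc (toℕ i + n-1) mod n     ≡⟨ cong (_mod n) (+-suc (toℕ i) n-1) ⟨
  (toℕ i + n) mod n           ≡⟨ toℕ-injective (trans (toℕ-mod (toℕ i + n) n) (trans ([m+n]%n≡m%n (toℕ i) n) (toℕ-% i))) ⟩
  i                           ∎

next-irreflexive : ∀ {n} → 2 ≤ n → (i : Fin n) → i ≢ next i
next-irreflexive {suc zero} (s≤s ())
-- Cancelling `toℕ i` from a fixed point leaves `0 % n ≡ 1 % n`; for `n` at least 2 the two sides
-- compute to 0 and 1.
next-irreflexive {n@(suc (suc _))} _ i eq = 0≢1+n (%-cancel-+ˡ (toℕ i) {0} {1} n (begin
  (toℕ i + 0) % n  ≡⟨ cong (_% n) (+-identityʳ (toℕ i)) ⟩
  toℕ i % n        ≡⟨ toℕ-% i ⟩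
  toℕ i            ≡⟨ cong toℕ eq ⟩
  toℕ (next i)     ≡⟨ toℕ-next i ⟩
  suc (toℕ i) % n  ≡⟨ cong (_% n) (+-comm 1 (toℕ i)) ⟩
  (toℕ i + 1) % n  ∎))

-- Cardinalities of tabulated subsets.

∣tabulate∣-++ : ∀ m {n} (f : Fin (m + n) → Bool) →
  ∣ tabulate f ∣ ≡ ∣ tabulate (f ∘ (_↑ˡ n)) ∣ + ∣ tabulate (f ∘ (m ↑ʳ_)) ∣
∣tabulate∣-++ zero    f = refl
∣tabulate∣-++ (suc m) f with f zero
... | true  = cong suc (∣tabulate∣-++ m (f ∘ suc))
... | false = ∣tabulate∣-++ m (f ∘ suc)

∣tabulate-true∣ : ∀ n → ∣ tabulate {n = n} (const true) ∣ ≡ n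
∣tabulate-true∣ zero    = refl
∣tabulate-true∣ (suc n) = cong suc (∣tabulate-true∣ n)

∣tabulate-false∣ : ∀ n → ∣ tabulate {n = n} (const false) ∣ ≡ 0
∣tabulate-false∣ zero    = refl
∣tabulate-false∣ (suc n) = ∣tabulate-false∣ n

-- Every fibre of `quotient` has `n` elements: the first `n` indices have quotient zero, and the
-- others reduce to the case of `m` one smaller. Degrees in the blow-up thus become `d` times
-- degrees in the `t`-cycle.
∣tabulate∘quotient∣ : ∀ {m} n (f : Fin m → Bool) →
  ∣ tabulate (f ∘ quotient {m} n) ∣ ≡ ∣ tabulate f ∣ * n
∣tabulate∘quotient∣ {zero}  n f = refl
∣tabulate∘quotient∣ {suc m} n f = trans split (step (f zero))
  where
  first : ∀ i → quotient {suc m} n (i ↑ˡ (m * n)) ≡ zero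
  first i rewrite splitAt-↑ˡ n i (m * n) = refl

  rest : ∀ i → quotient {suc m} n (n ↑ʳ i) ≡ suc (quotient n i)
  rest i rewrite splitAt-↑ʳ n (m * n) i = refl

  split : ∣ tabulate (f ∘ quotient {suc m} n) ∣ ≡ ∣ tabulate {n = n} (const (f zero)) ∣ + ∣ tabulate (f ∘ suc) ∣ * n
  split = begin
    ∣ tabulate (f ∘ quotient {suc m} n) ∣
      ≡⟨ ∣tabulate∣-++ n (f ∘ quotient {suc m} n) ⟩
    _ ≡⟨ cong₂ (λ xs ys → ∣ xs ∣ + ∣ ys ∣) (tabulate-cong (λ i → cong f (first i))) (tabulate-cong (λ i → cong f (rest i))) ⟩
    ∣ tabulate {n = n} (const (f zero)) ∣ + ∣ tabulate (λ i → f (suc (quotient {m} n i))) ∣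
      ≡⟨ cong (∣ tabulate {n = n} (const (f zero)) ∣ +_) (∣tabulate∘quotient∣ n (f ∘ suc)) ⟩
    ∣ tabulate {n = n} (const (f zero)) ∣ + ∣ tabulate (f ∘ suc) ∣ * n ∎

  step : ∀ b → ∣ tabulate {n = n} (const b) ∣ + ∣ tabulate (f ∘ suc) ∣ * n
             ≡ ∣ b ∷ tabulate (f ∘ suc) ∣ * n
  step true  = cong (_+ ∣ tabulate (f ∘ suc) ∣ * n) (∣tabulate-true∣ n)
  step false = cong (_+ ∣ tabulate (f ∘ suc) ∣ * n) (∣tabulate-false∣ n)

module _ {n} {P : Fin n → Set} (P? : ∀ i → Dec (P i)) where

  -- The tabulated subset is the singleton of `i`. This supplies the degrees of the `t`-cycle
  -- itself.
  ∣tabulate-unique∣ : ∀ {i} → P i → (∀ {j} → P j → j ≡ i) → ∣ tabulate (λ j → ⌊ P? j ⌋) ∣ ≡ 1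
  ∣tabulate-unique∣ {i} Pi unique = trans (cong ∣_∣ (⊆-antisym ⊆⁅i⁆ ⁅i⁆⊆)) (∣⁅x⁆∣≡1 i)
    where
    f = λ j → ⌊ P? j ⌋

    ⊆⁅i⁆ : ∀ {j} → j ∈ tabulate f → j ∈ ⁅ i ⁆
    ⊆⁅i⁆ {j} j∈ = subst (_∈ ⁅ i ⁆) (sym (unique Pj)) (x∈⁅x⁆ i)
      where Pj = toWitness (Equivalence.from T-≡ (trans (sym (lookup∘tabulate f j)) ([]=⇒lookup j∈)))

    ⁅i⁆⊆ : ∀ {j} → j ∈ ⁅ i ⁆ → j ∈ tabulate f
    ⁅i⁆⊆ {j} j∈ with refl ← x∈⁅y⁆⇒x≡y i j∈ =
      lookup⇒[]= j _ (trans (lookup∘tabulate f j) (Equivalence.to T-≡ (fromWitness Pi)))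

-- Zero sums and divisibility of the length.

toℕ-sumₖ-ones : ∀ k .{{_ : NonZero k}} n → toℕ (sumₖ {k} {n} (const 1ₖ)) ≡ n % k
toℕ-sumₖ-ones k zero    = toℕ-mod 0 k
toℕ-sumₖ-ones k (suc n) = begin
  toℕ (1ₖ +ₖ s)              ≡⟨ toℕ-mod (toℕ (1ₖ {k}) + toℕ s) k ⟩
  (toℕ (1ₖ {k}) + toℕ s) % k ≡⟨ cong₂ (λ x y → (x + y) % k) (toℕ-mod 1 k) (toℕ-sumₖ-ones k n) ⟩
  (1 % k + n % k) % k        ≡⟨ %-distribˡ-+ 1 n k ⟨
  suc n % k                  ∎
  where s = sumₖ {k} {n} (const 1ₖ)

zeroSum-ones⇒∣length : ∀ {G} k .{{_ : NonZero k}} (C : Cycle G) →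
  ZeroSum {G} (constant {G} (1ₖ {k})) C → k ∣ length C
zeroSum-ones⇒∣length k C eq = m%n≡0⇒n∣m (length C) k (begin
  length C % k                              ≡⟨ toℕ-sumₖ-ones k (length C) ⟨
  toℕ (sumₖ {k} {length C} (const 1ₖ))      ≡⟨ cong toℕ eq ⟩
  toℕ (0ₖ {k})                              ≡⟨ toℕ-mod 0 k ⟩
  0 % k                                     ≡⟨ n∣m⇒m%n≡0 0 k (divides-refl 0) ⟩
  0                                         ∎)

-- Writing `o` as `q * m`, coprimality forces `n` to divide the cofactor `q`.
coprime-*-∣ : ∀ {m n o} → Coprime m n → m ∣ o → n ∣ o → m * n ∣ o
coprime-*-∣ {m} {n} c (divides-refl q) n∣qm =
  subst (m * n ∣_) (*-comm m q)
    (*-monoʳ-∣ m (coprime-divisor (Coprimality.sym c) (subst (n ∣_) (*-comm q m) n∣qm)))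

-- Packing bounds for disjoint long cycles.

module _ {G : Digraph} {m r} (C : Fin m → Cycle G) (r≤length : ∀ i → r ≤ length (C i)) where

  open Digraph G

  private
    -- Only the first `r` positions of each cycle are used, so that cycles of different lengths
    -- contribute equally.
    position : (x : Fin (m * r)) → Fin (length (C (quotient r x)))
    position x = inject≤ (remainder {m} r x) (r≤length (quotient r x))

    -- Pigeonhole: pairs of a cycle and one of its first `r` positions embed into `Fin N`. Codes
    -- from one cycle differ by injectivity of `g i`, codes from two cycles by `across`.
    encoding⇒*≤ : ∀ {N} (g : ∀ i → Fin (length (C i)) → Fin N) →
      (∀ i → Injective _≡_ _≡_ (g i)) →
      (∀ i j → i ≢ j → ∀ p q → g i p ≢ g j q) →
      m * r ≤ N
    encoding⇒*≤ g within across = injective⇒≤ {f = λ x → g (quotient r x) (position x)} λ {x} {y} eq →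
      trans (sym (combine-remQuot {m} r x)) (trans (cong (uncurry combine) (same (remQuot r x) (remQuot r y) eq)) (combine-remQuot {m} r y))
      where
      -- Stated for pairs, so that matching `i ≡ j` with `refl` puts both positions in the same
      -- cycle, where they can be compared.
      same : ∀ (x y : Fin m × Fin r) →
        g (proj₁ x) (inject≤ (proj₂ x) (r≤length (proj₁ x))) ≡ g (proj₁ y) (inject≤ (proj₂ y) (r≤length (proj₁ y))) →
        x ≡ y
      same (i , p) (j , q) eq with i ≟ j
      ... | yes refl = cong (i ,_) (inject≤-injective _ _ p q (within i eq))
      ... | no  i≢j  = contradiction eq (across i j i≢j _ _)

  vertexDisjoint⇒*≤ : (∀ i j → i ≢ j → VertexDisjoint (C i) (C j)) → m * r ≤ order
  vertexDisjoint⇒*≤ disjoint =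
    encoding⇒*≤ (λ i → Cycle.vertex (C i)) (λ i → Cycle.distinct (C i)) disjoint

  -- Asking `code` to be injective only on edges allows `N` to be the number of edges instead of the
  -- number of all vertex pairs.
  edgeDisjoint⇒*≤ : ∀ {N} (code : Vertex → Vertex → Fin N) →
    (∀ {u v u′ v′} → Edge u v → Edge u′ v′ → code u v ≡ code u′ v′ → (u , v) ≡ (u′ , v′)) →
    (∀ i j → i ≢ j → EdgeDisjoint (C i) (C j)) → m * r ≤ N
  edgeDisjoint⇒*≤ code code-injective disjoint =
    encoding⇒*≤ (λ i p → uncurry code (Cycle.ends (C i) p))
      -- Two edges of one cycle are already told apart by their tails.
      (λ i eq → Cycle.distinct (C i) (,-injectiveˡ (code-injective (Cycle.edge (C i) _) (Cycle.edge (C i) _) eq)))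
      (λ i j i≢j p q eq → disjoint i j i≢j p q (code-injective (Cycle.edge (C i) p) (Cycle.edge (C j) q) eq))

-- The blown-up directed cycle.

-- The vertex of cyclic level i and number a is combine i a; its level is its quotient.
module BlownUpCycle (t d : ℕ) (2≤t : 2 ≤ t) (1≤d : 1 ≤ d) where

  instance
    t≢0 : NonZero t
    t≢0 = >-nonZero (<-trans z<s 2≤t)

    d≢0 : NonZero d
    d≢0 = >-nonZero 1≤d

  level : Fin (t * d) → Fin t
  level = quotient d

  G : Digraph
  G = record
    { order    = t * d
    ; nonempty = m*n≢0 t d
    ; adj      = λ u v → ⌊ level v ≟ next (level u) ⌋
    ; loopless = λ v loop → next-irreflexive 2≤t (level v) (toWitness loop)
    }

  open Digraph G using (Vertex; Edge)

  level-edge : ∀ {u v} → Edge u v → level v ≡ next (level u)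
  level-edge = toWitness

  regular : Regular d G
  regular v = outdegree≡d , indegree≡d
    where
    outdegree≡d = begin
      _ ≡⟨ ∣tabulate∘quotient∣ d (λ i → ⌊ i ≟ next (level v) ⌋) ⟩
      _ ≡⟨ cong (_* d) (∣tabulate-unique∣ (_≟ next (level v)) refl (λ eq → eq)) ⟩
      1 * d ≡⟨ *-identityˡ d ⟩
      d ∎

    indegree≡d = begin
      _ ≡⟨ ∣tabulate∘quotient∣ d (λ i → ⌊ level v ≟ next i ⌋) ⟩
      -- The only level with edges into `v` is `prev (level v)`; uniqueness is injectivity of
      -- `next`.
      _ ≡⟨ cong (_* d) (∣tabulate-unique∣ (λ i → level v ≟ next i) (sym (next-prev (level v)))
             (λ eq → next-injective (trans (sym eq) (sym (next-prev (level v)))))) ⟩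
      1 * d ≡⟨ *-identityˡ d ⟩
      d ∎

  -- One turn around the cycle advances the level by the length modulo `t` and ends at the starting
  -- level; cancelling that level makes the length zero modulo `t`.
  t∣length : (C : Cycle G) → t ∣ length C
  t∣length C = m%n≡0⇒n∣m ℓ t (trans (%-cancel-+ˡ (toℕ (walk 0)) t returns) (n∣m⇒m%n≡0 0 t (divides-refl 0)))
    where
    open Cycle C using (vertex; edge; 2≤length)
    ℓ = length C

    instance
      ℓ≢0 : NonZero ℓ
      ℓ≢0 = >-nonZero (<-trans z<s 2≤length)

    -- The cycle is unrolled over the naturals, so that induction on the number of steps passes the
    -- wrap-around from the last index to the first.
    walk : ℕ → Fin t
    walk n = level (vertex (n mod ℓ))

    walk-suc : ∀ n → walk (suc n) ≡ next (walk n)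
    walk-suc n = trans (cong (level ∘ vertex) (sym (next-mod n ℓ))) (level-edge (edge (n mod ℓ)))

    toℕ-walk : ∀ n → toℕ (walk n) ≡ (toℕ (walk 0) + n) % t
    toℕ-walk zero    = sym (trans (cong (_% t) (+-identityʳ _)) (toℕ-% (walk 0)))
    toℕ-walk (suc n) = begin
      toℕ (walk (suc n))                 ≡⟨ cong toℕ (walk-suc n) ⟩
      toℕ (next (walk n))                ≡⟨ toℕ-next (walk n) ⟩
      suc (toℕ (walk n)) % t             ≡⟨ cong (λ x → suc x % t) (toℕ-walk n) ⟩
      suc ((toℕ (walk 0) + n) % t) % t   ≡⟨ %-cong-+ˡ 1 t (m%n%n≡m%n (toℕ (walk 0) + n) t) ⟩
      suc (toℕ (walk 0) + n) % t         ≡⟨ cong (_% t) (+-suc (toℕ (walk 0)) n) ⟨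
      (toℕ (walk 0) + suc n) % t         ∎

    ℓmodℓ≡0modℓ : ℓ mod ℓ ≡ 0 mod ℓ
    ℓmodℓ≡0modℓ = toℕ-injective (trans (toℕ-mod ℓ ℓ) (trans ([m+n]%n≡m%n 0 ℓ) (sym (toℕ-mod 0 ℓ))))

    returns : (toℕ (walk 0) + ℓ) % t ≡ (toℕ (walk 0) + 0) % t
    returns = begin
      (toℕ (walk 0) + ℓ) % t  ≡⟨ toℕ-walk ℓ ⟨
      toℕ (walk ℓ)            ≡⟨ cong (toℕ ∘ level ∘ vertex) ℓmodℓ≡0modℓ ⟩
      toℕ (walk 0)            ≡⟨ toℕ-walk 0 ⟩
      (toℕ (walk 0) + 0) % t  ∎

  -- Only the remainder of v is recorded: along an edge, u determines the level of v.
  edgeCode : Vertex → Vertex → Fin (t * d * d)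
  edgeCode u v = combine u (remainder {t} d v)

  edgeCode-injective : ∀ {u v u′ v′} → Edge u v → Edge u′ v′ →
    edgeCode u v ≡ edgeCode u′ v′ → (u , v) ≡ (u′ , v′)
  edgeCode-injective {u} {v} {u′} {v′} uv u′v′ eq
    with u≡u′ , a≡a′ ← combine-injective u (remainder {t} d v) u′ (remainder {t} d v′) eq =
    cong₂ _,_ u≡u′ (begin
      v                                    ≡⟨ combine-remQuot {t} d v ⟨
      combine (level v) (remainder {t} d v)    ≡⟨ cong₂ combine level≡ a≡a′ ⟩
      combine (level v′) (remainder {t} d v′)  ≡⟨ combine-remQuot {t} d v′ ⟩
      v′                                   ∎)
    where
    level≡ = trans (level-edge {u} {v} uv) (trans (cong (next ∘ level) (proj₁ (combine-injective u _ u′ _ eq))) (sym (level-edge {u′} {v′} u′v′)))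

  -- Zero-sum cycles in the blown-up cycle.

  module _ (k : ℕ) .{{_ : NonZero k}} (t⊥k : Coprime t k) where

    ZeroSumCycle : Cycle G → Set
    ZeroSumCycle = ZeroSum {G} (constant {G} (1ₖ {k}))

    t*k≤length : ∀ C → ZeroSumCycle C → t * k ≤ length C
    -- Divisibility yields the inequality because a cycle has positive length.
    t*k≤length C zs = ∣⇒≤ (coprime-*-∣ t⊥k (t∣length C) (zeroSum-ones⇒∣length {G} k C zs))
      where
      instance
        length≢0 : NonZero (length C)
        length≢0 = >-nonZero (<-trans z<s (Cycle.2≤length C))

    -- Both the vertex count `t * d` and the edge count `t * d * d` carry a factor `t`. Cancelling
    -- it leaves `m * k ≤ n`, and division by `k` gives the floor.
    cancel-t : ∀ {m n} → m * (t * k) ≤ t * n → m ≤ n / k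
    cancel-t {m} {n} le = subst (_≤ n / k) (m*n/n≡m m k) (/-monoˡ-≤ k (*-cancelˡ-≤ t (subst (_≤ t * n) rearrange le)))
      where
      rearrange : m * (t * k) ≡ t * (m * k)
      rearrange = trans (sym (*-assoc m t k)) (trans (cong (_* k) (*-comm m t)) (*-assoc t m k))

    atMost-vertexDisjoint : AtMost (d / k) VertexDisjoint ZeroSumCycle
    atMost-vertexDisjoint m C zs disjoint =
      cancel-t (vertexDisjoint⇒*≤ C (λ i → t*k≤length (C i) (zs i)) disjoint)

    atMost-edgeDisjoint : AtMost (d ^ 2 / k) EdgeDisjoint ZeroSumCycle
    atMost-edgeDisjoint m C zs disjoint =
      cancel-t (subst (m * (t * k) ≤_) t*d*d≡t*d^2
        (edgeDisjoint⇒*≤ C (λ i → t*k≤length (C i) (zs i)) edgeCode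
          (λ {u} {v} {u′} {v′} → edgeCode-injective {u} {v} {u′} {v′}) disjoint))
      where
      t*d*d≡t*d^2 : t * d * d ≡ t * d ^ 2
      t*d*d≡t*d^2 = trans (*-assoc t d d) (cong (λ x → t * (d * x)) (sym (*-identityʳ d)))

    no-zeroSum : d < k → ∀ C → ¬ ZeroSumCycle C
    -- A single cycle is a vacuously disjoint family of size 1, while `d / k` is 0.
    no-zeroSum d<k C zs = n≮0 (subst (1 ≤_) (m<n⇒m/n≡0 d<k)
      (atMost-vertexDisjoint 1 (const C) (const zs) λ { zero zero 0≢0 → contradiction refl 0≢0 }))

proposition6p1 :
    ∀ (k d t : ℕ) .{{_ : NonZero k}} →
    2 ≤ k → 1 ≤ d → 2 ≤ t → Coprime t k →
    Σ[ G ∈ Digraph ]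
      let ones : Labelling G k
          ones = constant {G} 1ₖ
          ZeroSumCycle : Cycle G → Set
          ZeroSumCycle C = ZeroSum {G} ones C
      in
        Regular d G
      × (∀ (C : Cycle G) → ZeroSumCycle C → t * k ≤ length C)
      × AtMost (d / k) VertexDisjoint ZeroSumCycle
      × AtMost (d ^ 2 / k) EdgeDisjoint ZeroSumCycle
      × (d < k → ∀ (C : Cycle G) → ¬ ZeroSumCycle C)
proposition6p1 k d t _ 1≤d 2≤t t⊥k =
  G , regular , t*k≤length k t⊥k , atMost-vertexDisjoint k t⊥k , atMost-edgeDisjoint k t⊥k , no-zeroSum k t⊥k
  where open BlownUpCycle t d 2≤t 1≤d
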